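{- Let $G$ be a finite simple connected graph. If $\mathrm{fes}(G)\leq 2$, then $\mathrm{dem}(G)\leq \mathrm{fes}(G)+1$. Moreover, if $\mathrm{fes}(G)\leq 1$, then equality $\mathrm{dem}(G)=\mathrm{fes}(G)+1$ holds.
   Context: $d_G(x,y)$ denotes the distance between vertices $x,y$ in $G$ (equal to $\infty$ if $x$ and $y$ are in different components), and $G-e$ is the graph obtained from $G$ by deleting the edge $e$. An edge $e$ of $G$ is monitored by a vertex $x$ if there is a vertex $y$ of $G$ with $d_G(x,y)\neq d_{G-e}(x,y)$ (equivalently, $e$ belongs to all shortest paths between $x$ and $y$ in $G$). A set $M\subseteq V(G)$ is distance-edge-monitoring if every edge of $G$ is monitored by some vertex of $M$, and $\mathrm{dem}(G)$ is the smallest size of a distance-edge-monitoring set of $G$. A feedback edge set of $G$ is a set of edges whose removal from $G$ leaves a forest; $\mathrm{fes}(G)$ is the smallest size of a feedback edge set of $G$.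
   Formalization: The equality dem(G) = fes(G)+1 for fes(G) ≤ 1 is proved for G with at least one edge; it fails for the one-vertex graph, where fes(G) = 0 and the empty set is vacuously distance-edge-monitoring, so dem(G) = 0. -}

module Defs where

open import Data.Empty using (⊥)
open import Data.Fin.Base using (Fin; _<_)
open import Data.Fin.Properties using (_≟_)
open import Data.Fin.Subset using (Subset; _∈_; ∣_∣)
open import Data.List.Base using (List; []; _∷_; [_]; _∷ʳ_; length)
open import Data.List.Relation.Unary.All using (All)
open import Data.List.Relation.Unary.Any using (Any; any?)
open import Data.List.Relation.Unary.Linked using (Linked)
open import Data.List.Relation.Unary.Unique.Propositional using (Unique)
open import Data.Nat.Base using (ℕ; zero; suc; _≤_)
open import Data.Product.Base using (_×_; _,_; ∃; ∃-syntax)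
open import Data.Product.Properties using (≡-dec)
open import Data.Sum.Base using (_⊎_; swap)
open import Level using (0ℓ)
open import Relation.Binary.Core using (Rel)
open import Relation.Binary.Definitions using (Decidable; Symmetric; Irreflexive)
open import Relation.Binary.PropositionalEquality.Core using (_≡_; _≢_)
open import Relation.Nullary.Construct.Add.Supremum using (_⁺; ⊤⁺)
  renaming ([_] to fin)
open import Relation.Nullary.Decidable using (_×-dec_; _⊎-dec_; ¬?)
open import Relation.Nullary.Negation.Core using (¬_)
open import Relation.Unary using (Pred)
import Data.List.Relation.Unary.Any as Any

record Graph (n : ℕ) : Set₁ where
  field
    Adj    : Rel (Fin n) 0ℓ
    adj?   : Decidable Adj
    sym    : Symmetric Adj
    irrefl : Irreflexive _≡_ Adj

open Graph public

IsLeast : Pred ℕ 0ℓ → Pred ℕ 0ℓ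
IsLeast P k = P k × (∀ {j} → P j → k ≤ j)

private
  variable
    n : ℕ

-- An unordered edge is stored as the pair of its endpoints, smaller one first,
-- so that distinct pairs are distinct edges and edge sets can be counted.
IsEdge : Graph n → Pred (Fin n × Fin n) 0ℓ
IsEdge G (u , v) = u < v × Adj G u v

Joins : Fin n × Fin n → Rel (Fin n) 0ℓ
Joins e x y = e ≡ (x , y) ⊎ e ≡ (y , x)

joins? : (e : Fin n × Fin n) → Decidable (Joins e)
joins? e x y = ≡-dec _≟_ _≟_ e (x , y) ⊎-dec ≡-dec _≟_ _≟_ e (y , x)

infixl 6 _∖_

_∖_ : Graph n → List (Fin n × Fin n) → Graph n
Adj    (G ∖ F) x y = Adj G x y × ¬ Any (λ e → Joins e x y) F
adj?   (G ∖ F) x y = adj? G x y ×-dec ¬? (any? (λ e → joins? e x y) F)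
sym    (G ∖ F) (a , ∉F) = sym G a , λ ∈F → ∉F (Any.map swap ∈F)
irrefl (G ∖ F) x≡y (a , _) = irrefl G x≡y a

infixr 5 _∷_

data Walk (G : Graph n) : ℕ → Rel (Fin n) 0ℓ where
  []  : ∀ {x} → Walk G zero x x
  _∷_ : ∀ {k x y z} → Adj G x y → Walk G k y z → Walk G (suc k) x z

IsConnected : Graph n → Set
IsConnected G = ∀ x y → ∃[ k ] Walk G k x y

-- Distance G x y d says that d is the distance of x and y in G, with ⊤⁺ as ∞.
data Distance (G : Graph n) (x y : Fin n) : ℕ ⁺ → Set where
  finite   : ∀ {k} → IsLeast (λ j → Walk G j x y) k → Distance G x y (fin k)
  infinite : (∀ k → ¬ Walk G k x y) → Distance G x y ⊤⁺

Monitors : Graph n → Fin n → Fin n × Fin n → Set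
Monitors G x e = ∃[ y ] ∃[ d ] ∃[ d′ ]
  Distance G x y d × Distance (G ∖ [ e ]) x y d′ × d ≢ d′

IsMonitoringSet : Graph n → Subset n → Set
IsMonitoringSet G M = ∀ {e} → IsEdge G e → ∃[ x ] x ∈ M × Monitors G x e

-- IsDem G d reads dem(G) = d.
IsDem : Graph n → Pred ℕ 0ℓ
IsDem G = IsLeast λ k → ∃[ M ] IsMonitoringSet G M × ∣ M ∣ ≡ k

-- The list holds the vertices of a cycle once around, in order.
IsCycle : Graph n → Pred (List (Fin n)) 0ℓ
IsCycle G []       = ⊥
IsCycle G (x ∷ xs) =
  3 ≤ length (x ∷ xs) × Unique (x ∷ xs) × Linked (Adj G) (x ∷ xs ∷ʳ x)

IsForest : Graph n → Set
IsForest G = ¬ ∃ (IsCycle G)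

IsFeedbackEdgeSet : Graph n → List (Fin n × Fin n) → Set
IsFeedbackEdgeSet G F = All (IsEdge G) F × Unique F × IsForest (G ∖ F)

-- IsFes G f reads fes(G) = f.
IsFes : Graph n → Pred ℕ 0ℓ
IsFes G = IsLeast λ k → ∃[ F ] IsFeedbackEdgeSet G F × length F ≡ k

{-# OPTIONS --safe #-}

-- Fix a root r and a breadth-first tree.  The root monitors the edge from the
-- parent p of v to v unless v has a second neighbour one level closer to r, and
-- every vertex monitors the edges at it.  So r together with the farther end of
-- every non-tree edge is a monitoring set, and the number of non-tree edges is
-- fes(G): a forest has fewer edges than vertices, so the complement of a
-- feedback edge set is no larger than the tree.  This gives dem ≤ fes + 1
-- for every value of fes.
-- Conversely, if r alone monitors every edge then G has no cycle, as a vertex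
-- of a cycle farthest from r has two neighbours that are no farther.
module Submission where

open import Defs
open import Data.Empty using (⊥-elim)
open import Data.Fin.Base as Fin using (Fin; zero; suc)
open import Data.Fin.Properties as Fin using (_≟_; any?; suc-injective)
open import Data.Fin.Subset as Subset using (Subset; ∣_∣; inside; outside)
open import Data.Fin.Subset.Properties
  using (∣⊥∣≡0; x∈p⇒∣p-x∣<∣p∣; x∈p∧x≢y⇒x∈p-y)
open import Data.List.Base
  using (List; []; _∷_; [_]; _++_; _∷ʳ_; length; map; filter; tabulate; allFin; cartesianProduct)
open import Data.List.Extrema.Nat using (argmax; argmax-sel; f[xs]≤f[argmax]; f[⊥]≤f[argmax])
open import Data.List.Membership.Propositional using (_∈_; _∉_; find)
open import Data.List.Membership.Propositional.Properties
  using (∈-++⁺ˡ; ∈-++⁺ʳ; ∈-++⁻; ∈-filter⁺; ∈-filter⁻; ∈-tabulate⁻; ∈-allFin; ∈-map⁺;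
         ∈-cartesianProduct⁺)
open import Data.List.Properties using (filter-notAll; length-++; length-tabulate; length-map)
open import Data.List.Relation.Binary.Subset.Propositional using (_⊆_)
open import Data.List.Relation.Unary.All as All using (All; []; _∷_)
open import Data.List.Relation.Unary.AllPairs using ([]; _∷_)
open import Data.List.Relation.Unary.Any as Any using (Any; here; there)
open import Data.List.Relation.Unary.Linked as Linked using (Linked; [-]; _∷_)
open import Data.List.Relation.Unary.Unique.Propositional using (Unique)
import Data.List.Relation.Unary.Unique.Propositional.Properties as Unique
open import Data.Nat using (ℕ; zero; suc; _≤_; _<_; _+_; z≤n; s≤s; s≤s⁻¹; z<s)
open import Data.Nat.Properties as ℕ
  using (≤-refl; ≤-trans; ≤-antisym; ≤-reflexive; <-irrefl; anyUpTo?; module ≤-Reasoning)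
open import Data.Product using (_×_; _,_; ∃; ∃₂; ∃-syntax; proj₁; proj₂)
open import Data.Product.Properties using (≡-dec)
open import Data.Sum using (_⊎_; inj₁; inj₂; swap)
open import Data.Vec.Base using ([]; _∷_; _[_]≔_; here; there)
open import Data.Vec.Properties using ([]≔-updates; []≔-minimal)
open import Function.Base using (_∘_; id)
open import Level using (0ℓ)
open import Relation.Binary.Construct.Closure.ReflexiveTransitive as Star
  using (Star; ε; _◅_; _◅◅_)
open import Relation.Binary.Core using (Rel; _⇒_)
open import Relation.Binary.Definitions using (DecidableEquality; tri<; tri≈; tri>)
open import Relation.Binary.PropositionalEquality as ≡
  using (_≡_; _≢_; refl; cong; subst)
open import Relation.Nullary using (¬_; Dec; yes; no; ¬?; contradiction)
open import Relation.Nullary.Decidable using (map′; _×-dec_)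
open import Relation.Nullary.Construct.Add.Supremum using (⊤⁺) renaming ([_] to fin)
open import Relation.Unary using (Pred; Decidable)

private
  variable
    n : ℕ

-- Least numbers, list lengths and edge ends.

Edge : ℕ → Set
Edge n = Fin n × Fin n

least : ∀ {P : Pred ℕ 0ℓ} → Decidable P → ∀ {k} → P k → ∃ (IsLeast P)
least P? {zero}  p = zero , p , λ _ → z≤n
least P? {suc k} p with P? zero
... | yes p₀ = zero , p₀ , λ _ → z≤n
... | no ¬p₀ with least (P? ∘ suc) p
...   | m , pm , m≤ = suc m , pm , λ { {zero} p₀ → contradiction p₀ ¬p₀ ; {suc j} pj → s≤s (m≤ pj) }

IsLeast-unique : ∀ {P : Pred ℕ 0ℓ} {j k} → IsLeast P j → IsLeast P k → j ≡ k
IsLeast-unique (pj , j≤) (pk , k≤) = ≤-antisym (j≤ pk) (k≤ pj)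

module _ {A : Set} (_≟ᴬ_ : DecidableEquality A) where

  -- Pigeonhole: deleting `x` from `ys` shortens it strictly and still keeps the tail inside, since
  -- `x` does not recur there.
  Unique-⊆⇒length≤ : ∀ {xs ys : List A} → Unique xs → xs ⊆ ys → length xs ≤ length ys
  Unique-⊆⇒length≤ [] _ = z≤n
  Unique-⊆⇒length≤ {x ∷ xs} {ys} (x∉xs ∷ u) xs⊆ys =
    ≤-trans
      (s≤s (Unique-⊆⇒length≤ u λ y∈xs →
        ∈-filter⁺ ≢x? (xs⊆ys (there y∈xs)) (λ y≡x → All.lookup x∉xs y∈xs (≡.sym y≡x))))
      (filter-notAll ≢x? ys (Any.map (λ x≡y y≢x → y≢x (≡.sym x≡y)) (xs⊆ys (here refl))))
    where
    ≢x? : Decidable (_≢ x)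
    ≢x? y = ¬? (y ≟ᴬ x)

_≟ₑ_ : DecidableEquality (Edge n)
_≟ₑ_ = ≡-dec _≟_ _≟_

Joins-injectiveˡ : ∀ {e : Edge n} {a b c} → Joins e a c → Joins e b c → a ≡ b
Joins-injectiveˡ (inj₁ refl) (inj₁ refl) = refl
Joins-injectiveˡ (inj₁ refl) (inj₂ refl) = refl
Joins-injectiveˡ (inj₂ refl) (inj₁ refl) = refl
Joins-injectiveˡ (inj₂ refl) (inj₂ refl) = refl

Joins-match : ∀ {e : Edge n} {a b c d} → Joins e a b → Joins e c d →
              (a ≡ c × b ≡ d) ⊎ (a ≡ d × b ≡ c)
Joins-match (inj₁ refl) (inj₁ refl) = inj₁ (refl , refl)
Joins-match (inj₁ refl) (inj₂ refl) = inj₂ (refl , refl)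
Joins-match (inj₂ refl) (inj₁ refl) = inj₂ (refl , refl)
Joins-match (inj₂ refl) (inj₂ refl) = inj₁ (refl , refl)

-- Repetition-free paths.

infixr 5 _∷_

-- The list holds the vertices after the first one.
data Path {n} (R : Rel (Fin n) 0ℓ) : Fin n → List (Fin n) → Fin n → Set where
  []  : ∀ {x} → Path R x [] x
  _∷_ : ∀ {x y ys z} → R x y → Path R y ys z → Path R x (y ∷ ys) z

module _ {R : Rel (Fin n) 0ℓ} where

  suffix : ∀ {x xs z v} → Path R x xs z → Unique (x ∷ xs) → v ∈ x ∷ xs →
           ∃[ ys ] Path R v ys z × Unique (v ∷ ys)
  suffix p       u       (here refl) = _ , p , u
  suffix (_ ∷ p) (_ ∷ u) (there v∈)  = suffix p u v∈

  -- Loops are cut as they arise: if `x` already lies on the path found for the rest, the part of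
  -- that path starting at `x` is taken instead.
  Star⇒Path : ∀ {x z} → Star R x z → ∃[ xs ] Path R x xs z × Unique (x ∷ xs)
  Star⇒Path ε = [] , [] , [] ∷ []
  Star⇒Path {x} (_◅_ {j = y} r s) with Star⇒Path s
  ... | ys , p , u with Any.any? (x ≟_) (y ∷ ys)
  ...   | yes x∈ = suffix p u x∈
  ...   | no  x∉ = y ∷ ys , r ∷ p , All.tabulate (λ y∈ x≡y → x∉ (subst (_∈ y ∷ ys) (≡.sym x≡y) y∈)) ∷ u

  Path⇒Linked : ∀ {Q : Rel (Fin n) 0ℓ} {x xs z t} → R ⇒ Q → Path R x xs z → Q z t →
                Linked Q (x ∷ xs ∷ʳ t)
  Path⇒Linked R⇒Q []      q = q ∷ [-]
  Path⇒Linked R⇒Q (r ∷ p) q = R⇒Q r ∷ Path⇒Linked R⇒Q p q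

-- Walks and distances

module _ {G : Graph n} where

  snoc : ∀ {k x y z} → Walk G k x y → Adj G y z → Walk G (suc k) x z
  snoc []      b = b ∷ []
  snoc (a ∷ p) b = a ∷ snoc p b

  unsnoc : ∀ {k x z} → Walk G (suc k) x z → ∃[ y ] Walk G k x y × Adj G y z
  unsnoc (a ∷ [])      = _ , [] , a
  unsnoc (a ∷ p@(_ ∷ _)) with unsnoc p
  ... | y , q , b = y , a ∷ q , b

  Walk⇒Star : ∀ {k x y} → Walk G k x y → Star (Adj G) x y
  Walk⇒Star []      = ε
  Walk⇒Star (a ∷ p) = a ◅ Walk⇒Star p

  Path⇒Walk : ∀ {x xs y} → Path (Adj G) x xs y → Walk G (length xs) x y
  Path⇒Walk []      = []
  Path⇒Walk (a ∷ p) = a ∷ Path⇒Walk p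

  Walk-map : ∀ {H : Graph n} → Adj G ⇒ Adj H → ∀ {k x y} → Walk G k x y → Walk H k x y
  Walk-map f []      = []
  Walk-map f (a ∷ p) = f a ∷ Walk-map f p

  walk-0 : ∀ {x y} → Walk G 0 x y → x ≡ y
  walk-0 [] = refl

module _ (G : Graph n) where

  walk? : ∀ k x y → Dec (Walk G k x y)
  walk? zero x y = map′ (λ { refl → [] }) walk-0 (x ≟ y)
  walk? (suc k) x y =
    map′ (λ (_ , a , p) → a ∷ p) (λ { (a ∷ p) → _ , a , p })
         (any? λ z → adj? G x z ×-dec walk? k z y)

  -- Bounds the search for a walk: a path without repetition has at most `n` vertices, hence fewer
  -- than `n` edges.
  short-walk : ∀ {k x y} → Walk G k x y → ∃[ j ] j < n × Walk G j x y
  short-walk p with Star⇒Path (Walk⇒Star p)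
  ... | xs , q , u =
    length xs
    , subst (length xs <_) (length-tabulate id) (Unique-⊆⇒length≤ _≟_ u (λ _ → ∈-allFin _))
    , Path⇒Walk q

  -- Supplies the distance after a deletion, which `Monitors` wants as a witness and which may be
  -- `⊤⁺`.
  distance : ∀ x y → ∃ (Distance G x y)
  distance x y with anyUpTo? (λ k → walk? k x y) n
  ... | yes (_ , _ , p) with least (λ k → walk? k x y) p
  ...   | k , isLeast = fin k , finite isLeast
  distance x y | no ¬p = ⊤⁺ , infinite λ k p → ¬p (short-walk p)

module _ (G : Graph n) where

  orient : ∀ {u v} → Adj G u v → ∃[ e ] IsEdge G e × Joins e u v
  orient {u} {v} a with Fin.<-cmp u v
  ... | tri< u<v _ _ = (u , v) , (u<v , a) , inj₁ refl
  ... | tri≈ _ u≡v _ = contradiction a (irrefl G u≡v)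
  ... | tri> _ _ v<u = (v , u) , (v<u , sym G a) , inj₂ refl

  isEdge? : Decidable (IsEdge G)
  isEdge? (u , v) = u Fin.<? v ×-dec adj? G u v

  joins-adj : ∀ {e u v} → IsEdge G e → Joins e u v → Adj G u v
  joins-adj (_ , a) (inj₁ refl) = a
  joins-adj (_ , a) (inj₂ refl) = sym G a

  -- Every shortest walk from `x` to `v` ends with `e`, so without `e` no walk of length `suc k` is
  -- left; the new distance, whatever it is, differs.
  monitors-last : ∀ {x u v e k} → IsLeast (λ j → Walk G j x v) (suc k) → Joins e u v →
                  (∀ {w} → Walk G k x w → Adj G w v → w ≡ u) → Monitors G x e
  monitors-last {x} {u} {v} {e} {k} isLeast J unique with distance (G ∖ [ e ]) x v
  ... | d′ , D′ =
    v , fin (suc k) , d′ , finite isLeast , D′ , λ d≡d′ → lost (subst (Distance (G ∖ [ e ]) x v) (≡.sym d≡d′) D′)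
    where
    lost : ¬ Distance (G ∖ [ e ]) x v (fin (suc k))
    lost (finite (p , _)) with unsnoc p
    ... | w , q , a , ¬J with unique (Walk-map proj₁ q) a
    ...   | refl = ¬J (here J)

  -- The case `k = 0`: a walk of length zero would turn the edge into a loop, and the only vertex
  -- reached in no steps is `u` itself.
  monitors-incident : ∀ {u v e} → IsEdge G e → Joins e u v → Monitors G u e
  monitors-incident {u} {v} {e} isEdge J =
    monitors-last (a ∷ [] , λ { {zero} [] → ⊥-elim (irrefl G refl a) ; {suc _} _ → s≤s z≤n }) J
                  (λ p _ → ≡.sym (walk-0 p))
    where
    a : Adj G u v
    a = joins-adj isEdge J

-- Forests have fewer edges than vertices

JoinedBy : List (Edge n) → Rel (Fin n) 0ℓ
JoinedBy S x y = Any (λ e → Joins e x y) S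

module _ (G : Graph n) {S : List (Edge n)} (S⊆G : All (IsEdge G) S) where

  JoinedBy⇒Adj : JoinedBy S ⇒ Adj G
  JoinedBy⇒Adj i with find i
  ... | e , e∈S , J = joins-adj G (All.lookup S⊆G e∈S) J

  JoinedBy⇒∈ : ∀ {u v} → u Fin.< v → JoinedBy S u v → (u , v) ∈ S
  JoinedBy⇒∈ u<v i with find i
  ... | _ , e∈S , inj₁ refl = e∈S
  ... | _ , e∈S , inj₂ refl = contradiction (proj₁ (All.lookup S⊆G e∈S)) (Fin.<-asym u<v)

  -- A simple path through `S` from `u` to `v` is either the edge `e`, which is not in `S`, or has
  -- at least three vertices and closes up with `e` to a cycle.
  separated : IsForest G → ∀ {e@(u , v) : Edge n} → IsEdge G e → e ∉ S → ¬ Star (JoinedBy S) u v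
  separated forest {u , v} (u<v , a) e∉S s with Star⇒Path s
  ... | [] , [] , _ = Fin.<⇒≢ u<v refl
  ... | _ ∷ [] , i ∷ [] , _ = e∉S (JoinedBy⇒∈ u<v i)
  ... | xs@(_ ∷ _ ∷ _) , p , un =
    forest (u ∷ xs , s≤s (s≤s (s≤s z≤n)) , un , Path⇒Linked JoinedBy⇒Adj p (sym G a))

module _ (G : Graph n) (forest : IsForest G) where

  -- Union-find: roots lists a superset of the labels in use.
  record Components (S : List (Edge n)) : Set where
    field
      label      : Fin n → Fin n
      roots      : List (Fin n)
      label∈     : ∀ x → label x ∈ roots
      bounded    : length S + length roots ≤ n
      label≡⇒Star : ∀ {x y} → label x ≡ label y → Star (JoinedBy S) x y

  -- Adding an edge relabels the class of `u` as that of `v`. In a forest the two labels differ, so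
  -- `label u` can leave `roots`; this loss pays for the new edge in `bounded`.
  components : ∀ {S} → All (IsEdge G) S → Unique S → Components S
  components [] [] = record
    { label = id ; roots = allFin n ; label∈ = ∈-allFin
    ; bounded = ≤-reflexive (length-tabulate id) ; label≡⇒Star = λ { refl → ε } }
  components {(u , v) ∷ S} (isEdge ∷ S⊆G) (e∉S ∷ un) = record
    { label = label′ ; roots = filter ≢ᵘ? roots ; label∈ = label′∈
    ; bounded = bounded′ ; label≡⇒Star = label′≡⇒Star _ _ }
    where
    open Components (components S⊆G un)

    ≢ᵘ? : Decidable (_≢ label u)
    ≢ᵘ? x = ¬? (x ≟ label u)

    apart : label v ≢ label u
    apart eq = separated G S⊆G forest isEdge (λ e∈S → All.lookup e∉S e∈S refl) (label≡⇒Star (≡.sym eq))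

    label′ : Fin n → Fin n
    label′ x with label x ≟ label u
    ... | yes _ = label v
    ... | no  _ = label x

    label′∈ : ∀ x → label′ x ∈ filter ≢ᵘ? roots
    label′∈ x with label x ≟ label u
    ... | yes _ = ∈-filter⁺ ≢ᵘ? (label∈ v) apart
    ... | no ≢u = ∈-filter⁺ ≢ᵘ? (label∈ x) ≢u

    bounded′ : suc (length S) + length (filter ≢ᵘ? roots) ≤ n
    bounded′ = begin
      suc (length S + length (filter ≢ᵘ? roots)) ≡⟨ ℕ.+-suc (length S) _ ⟨
      length S + suc (length (filter ≢ᵘ? roots)) ≤⟨ ℕ.+-monoʳ-≤ (length S) (filter-notAll ≢ᵘ? roots
                                                      (Any.map (λ eq ≢u → ≢u (≡.sym eq)) (label∈ u))) ⟩
      length S + length roots                    ≤⟨ bounded ⟩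
      n                                          ∎
      where open ≤-Reasoning

    old : ∀ {x y} → label x ≡ label y → Star (JoinedBy ((u , v) ∷ S)) x y
    old eq = Star.map there (label≡⇒Star eq)

    label′≡⇒Star : ∀ x y → label′ x ≡ label′ y → Star (JoinedBy ((u , v) ∷ S)) x y
    label′≡⇒Star x y eq with label x ≟ label u | label y ≟ label u
    ... | yes x~u | yes y~u = old (≡.trans x~u (≡.sym y~u))
    -- Here `eq` equates `label v` with `label y`, so the path crosses the new edge from `u` to `v`.
    ... | yes x~u | no  _   = old x~u ◅◅ here (inj₁ refl) ◅ old eq
    ... | no  _   | yes y~u = old eq ◅◅ here (inj₂ refl) ◅ old (≡.sym y~u)
    ... | no  _   | no  _   = old eq

  -- The label of `x` is still in `roots`, which makes `bounded` strict.
  forest-edges : ∀ {S} → Fin n → All (IsEdge G) S → Unique S → length S < n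
  forest-edges {S} x S⊆G un = begin-strict
    length S                ≡⟨ ℕ.+-identityʳ (length S) ⟨
    length S + 0            <⟨ ℕ.+-monoʳ-< (length S) (nonempty (label∈ x)) ⟩
    length S + length roots ≤⟨ bounded ⟩
    n                       ∎
    where
    open ≤-Reasoning
    open Components (components S⊆G un)
    nonempty : ∀ {y} {ys : List (Fin n)} → y ∈ ys → 0 < length ys
    nonempty (here _)  = z<s
    nonempty (there _) = z<s

-- Subsets given by lists, and subsets with at most one element.

ofList : List (Fin n) → Subset n
ofList []       = Subset.⊥
ofList (v ∷ vs) = ofList vs [ v ]≔ inside

insert-bound : ∀ (p : Subset n) v → ∣ p [ v ]≔ inside ∣ ≤ suc ∣ p ∣
insert-bound (inside  ∷ p) zero    = ℕ.n≤1+n _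
insert-bound (outside ∷ p) zero    = ≤-refl
insert-bound (inside  ∷ p) (suc v) = s≤s (insert-bound p v)
insert-bound (outside ∷ p) (suc v) = insert-bound p v

∣ofList∣≤length : ∀ (vs : List (Fin n)) → ∣ ofList vs ∣ ≤ length vs
∣ofList∣≤length {n} []   = ≤-reflexive (∣⊥∣≡0 n)
∣ofList∣≤length (v ∷ vs) = ≤-trans (insert-bound (ofList vs) v) (s≤s (∣ofList∣≤length vs))

∈-ofList : ∀ {v} {vs : List (Fin n)} → v ∈ vs → v Subset.∈ ofList vs
∈-ofList {vs = w ∷ vs} (here refl) = []≔-updates (ofList vs) w
∈-ofList {v = v} {vs = w ∷ vs} (there v∈) with v ≟ w
... | yes refl = []≔-updates (ofList vs) w
... | no  v≢w  = []≔-minimal (ofList vs) v w v≢w (∈-ofList v∈)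

nonempty⇒1≤∣p∣ : ∀ {x} {p : Subset n} → x Subset.∈ p → 1 ≤ ∣ p ∣
nonempty⇒1≤∣p∣ x∈p = ≤-trans (s≤s z≤n) (x∈p⇒∣p-x∣<∣p∣ x∈p)

∣p∣≤1⇒subsingleton : ∀ {x y} {p : Subset n} → ∣ p ∣ ≤ 1 → x Subset.∈ p → y Subset.∈ p → x ≡ y
∣p∣≤1⇒subsingleton {x = x} {y} ∣p∣≤1 x∈p y∈p with x ≟ y
... | yes x≡y = x≡y
... | no  x≢y = contradiction
  (≤-trans (s≤s (nonempty⇒1≤∣p∣ (x∈p∧x≢y⇒x∈p-y x∈p x≢y))) (≤-trans (x∈p⇒∣p-x∣<∣p∣ y∈p) ∣p∣≤1))
  (<-irrefl refl)

-- Levels of a breadth-first search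

module Levels (G : Graph n) (connected : IsConnected G) (r : Fin n) where

  private
    leastWalk : ∀ v → ∃ (IsLeast λ j → Walk G j r v)
    leastWalk v = least (λ k → walk? G k r v) (proj₂ (connected r v))

  lev : Fin n → ℕ
  lev v = proj₁ (leastWalk v)

  lev-isLeast : ∀ v → IsLeast (λ j → Walk G j r v) (lev v)
  lev-isLeast v = proj₂ (leastWalk v)

  lev-walk : ∀ v → Walk G (lev v) r v
  lev-walk v = proj₁ (lev-isLeast v)

  lev≤ : ∀ {v k} → Walk G k r v → lev v ≤ k
  lev≤ = proj₂ (lev-isLeast _)

  lev-step : ∀ {u v} → Adj G u v → lev v ≤ suc (lev u)
  lev-step a = lev≤ (snoc (lev-walk _) a)

  -- The walk without its last step bounds `lev u` from above, `lev-step` from below.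
  predecessor : ∀ {k v} → lev v ≡ suc k → ∃[ u ] Adj G u v × lev u ≡ k
  predecessor {k} {v} eq with unsnoc (subst (λ j → Walk G j r v) eq (lev-walk v))
  ... | u , p , a = u , a , ≤-antisym (lev≤ p) (s≤s⁻¹ (subst (_≤ suc (lev u)) eq (lev-step a)))

  parent : ∀ {v} → v ≢ r → ∃[ u ] Adj G u v × suc (lev u) ≡ lev v
  parent {v} v≢r with lev v in eq
  ... | zero  = contradiction (≡.sym (walk-0 (subst (λ j → Walk G j r v) eq (lev-walk v)))) v≢r
  ... | suc k with predecessor eq
  ...   | u , a , refl = u , a , refl

  -- An edge between two levels has only one deeper end; this lets a tree edge determine its child.
  upper-end-unique : ∀ {e p q u v} → Joins e p u → Joins e q v → lev p < lev u → lev q < lev v → u ≡ v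
  upper-end-unique J K p<u q<v with Joins-match J K
  ... | inj₁ (_ , u≡v)     = u≡v
  ... | inj₂ (refl , refl) = contradiction q<v (ℕ.<-asym p<u)

  -- `bypass` covers both ways for `e` to be dispensable: inside a level it holds vacuously, and
  -- between levels it provides a second predecessor.
  module _ {e : Edge n}
           (bypass : ∀ {a b} → Joins e a b → suc (lev a) ≡ lev b →
                     ∃[ c ] c ≢ a × Adj G c b × suc (lev c) ≡ lev b)
           where

    -- Built backwards from `v`: a step that would use `e` is replaced by one from `c`, which lies
    -- on the same level as `u`, so the length does not grow.
    avoiding-walk : ∀ k {v} → lev v ≡ k → Walk (G ∖ [ e ]) k r v
    avoiding-walk zero {v} eq = subst (Walk _ 0 r) (walk-0 (subst (λ j → Walk G j r v) eq (lev-walk v))) []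
    avoiding-walk (suc k) {v} eq with predecessor eq
    ... | u , a , eqᵤ with joins? e u v
    ...   | no ¬J = snoc (avoiding-walk k eqᵤ) (a , λ { (here J) → ¬J J })
    ...   | yes J with bypass J (≡.trans (cong suc eqᵤ) (≡.sym eq))
    ...     | c , c≢u , b , eq′ =
      snoc (avoiding-walk k (ℕ.suc-injective (≡.trans eq′ eq)))
           (b , λ { (here J′) → c≢u (Joins-injectiveˡ J′ J) })

    ¬monitors : ¬ Monitors G r e
    ¬monitors (y , d , d′ , D , D′ , d≢d′) = d≢d′ (≡.trans (dist D) (≡.sym (dist′ D′)))
      where
      isLeast′ : IsLeast (λ j → Walk (G ∖ [ e ]) j r y) (lev y)
      isLeast′ = avoiding-walk _ refl , λ p → lev≤ (Walk-map proj₁ p)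
      dist : ∀ {d} → Distance G r y d → d ≡ fin (lev y)
      dist (finite l)   = cong fin (IsLeast-unique l (lev-isLeast y))
      dist (infinite ∄) = contradiction (lev-walk y) (∄ _)
      dist′ : ∀ {d} → Distance (G ∖ [ e ]) r y d → d ≡ fin (lev y)
      dist′ (finite l)   = cong fin (IsLeast-unique l isLeast′)
      dist′ (infinite ∄) = contradiction (proj₁ isLeast′) (∄ _)

  -- If `b` shares the level of `v`, the edge between them is inside a level. Otherwise `b` lies one
  -- level closer and is the bypass for the edge from `a` to `v`.
  two-neighbours⇒¬monitored : ∀ {a b v} → a ≢ b → Adj G a v → Adj G b v → lev a ≤ lev v → lev b ≤ lev v →
                              ∃[ e ] IsEdge G e × ¬ Monitors G r e
  two-neighbours⇒¬monitored {a} {b} {v} a≢b av bv a≤v b≤v with lev b ℕ.≟ lev v | orient G av | orient G bv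
  ... | yes b≡v | _ | e , isEdge , J = e , isEdge , ¬monitors bypass
    where
    bypass : ∀ {p q} → Joins e p q → suc (lev p) ≡ lev q → _
    bypass Jpq eq with Joins-match Jpq J
    ... | inj₁ (refl , refl) = contradiction (≡.trans eq (≡.sym b≡v)) ℕ.1+n≢n
    ... | inj₂ (refl , refl) = contradiction (≡.trans eq b≡v) ℕ.1+n≢n
  ... | no b≢v | e , isEdge , J | _ = e , isEdge , ¬monitors bypass
    where
    bypass : ∀ {p q} → Joins e p q → suc (lev p) ≡ lev q → ∃[ c ] c ≢ p × Adj G c q × suc (lev c) ≡ lev q
    bypass Jpq eq with Joins-match Jpq J
    ... | inj₁ (refl , refl) = b , (λ b≡a → a≢b (≡.sym b≡a)) , bv , ≤-antisym (ℕ.≤∧≢⇒< b≤v b≢v) (lev-step bv)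
    ... | inj₂ (refl , refl) = contradiction (subst (_≤ lev v) (≡.sym eq) a≤v) (<-irrefl refl)

-- Neighbours along a cycle.

module _ {R : Rel (Fin n) 0ℓ} where

  last-neighbour : ∀ {y ys x} → Linked R (y ∷ ys ∷ʳ x) → ∃[ z ] z ∈ y ∷ ys × R z x
  last-neighbour {ys = []}    (r ∷ _) = _ , here refl , r
  last-neighbour {ys = _ ∷ _} (_ ∷ l) with last-neighbour l
  ... | z , z∈ , r = z , there z∈ , r

  -- The entries just before and after `v` serve. They could coincide only if `vs` is a single
  -- vertex between equal ends, which the length condition rules out; in the recursion the new left
  -- end differs from `q`, so that condition is vacuous.
  inner-neighbours : ∀ {p vs q v} → Linked R (p ∷ vs ∷ʳ q) → Unique (p ∷ vs) → All (_≢ q) vs →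
                     (p ≡ q → 2 ≤ length vs) → v ∈ vs →
                     ∃₂ λ a b → a ≢ b × a ∈ p ∷ vs ∷ʳ q × b ∈ p ∷ vs ∷ʳ q × R a v × R v b
  inner-neighbours {vs = w ∷ []} (r ∷ s ∷ _) _ _ long (here refl) =
    _ , _ , (λ p≡q → <-irrefl refl (long p≡q)) , here refl , there (there (here refl)) , r , s
  inner-neighbours {vs = w ∷ y ∷ ys} (r ∷ s ∷ _) ((_ ∷ p≢y ∷ _) ∷ _) _ _ (here refl) =
    _ , _ , p≢y , here refl , there (there (here refl)) , r , s
  inner-neighbours {vs = w ∷ ws} (_ ∷ l) (_ ∷ u) (w≢q ∷ ≢q) _ (there v∈)
    with inner-neighbours l u ≢q (λ w≡q → contradiction w≡q w≢q) v∈
  ... | a , b , a≢b , a∈ , b∈ , r , s = a , b , a≢b , there a∈ , there b∈ , r , s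

-- The first vertex lies between the second and the last. Any other is an inner vertex of the tour
-- from `x` back to `x`.
cycle-neighbours : ∀ {G : Graph n} {x xs v} → IsCycle G (x ∷ xs) → v ∈ x ∷ xs →
                   ∃₂ λ a b → a ≢ b × a ∈ x ∷ xs × b ∈ x ∷ xs × Adj G a v × Adj G b v
cycle-neighbours {G = G} {xs = y ∷ z ∷ zs} (_ , _ ∷ y∉ ∷ _ , a ∷ _ ∷ l) (here refl) with last-neighbour l
... | b , b∈ , adj = y , b , All.lookup y∉ b∈ , there (here refl) , there (there b∈) , sym G a , adj
cycle-neighbours {xs = _ ∷ []} (s≤s (s≤s ()) , _) _
cycle-neighbours {G = G} {x} {xs} (s≤s long , un@(x∉ ∷ _) , l) (there v∈)
  with inner-neighbours l un (All.map (λ x≢ ≡x → x≢ (≡.sym ≡x)) x∉) (λ _ → long) v∈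
... | a , b , a≢b , a∈ , b∈ , av , vb = a , b , a≢b , close a∈ , close b∈ , av , sym G vb
  where
  close : ∀ {w} → w ∈ x ∷ xs ∷ʳ x → w ∈ x ∷ xs
  close w∈ with ∈-++⁻ (x ∷ xs) w∈
  ... | inj₁ w∈        = w∈
  ... | inj₂ (here eq) = here eq

-- Lower bound for dem.

module _ (G : Graph n) (connected : IsConnected G) where

  monitored-by-one⇒forest : ∀ r → (∀ {e} → IsEdge G e → Monitors G r e) → IsForest G
  monitored-by-one⇒forest r monitored (x ∷ xs , cycle) =
    let a , b , a≢b , a∈ , b∈ , av , bv = cycle-neighbours {G = G} cycle (top∈ (argmax-sel lev x xs))
        e , isEdge , ¬mon               = two-neighbours⇒¬monitored a≢b av bv (≤top a∈) (≤top b∈)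
    in ¬mon (monitored isEdge)
    where
    open Levels G connected r
    top∈ : ∀ {v} → v ≡ x ⊎ v ∈ xs → v ∈ x ∷ xs
    top∈ (inj₁ eq) = here eq
    top∈ (inj₂ v∈) = there v∈
    ≤top : ∀ {w} → w ∈ x ∷ xs → lev w ≤ lev (argmax lev x xs)
    ≤top = All.lookup (f[⊥]≤f[argmax] {f = lev} x xs ∷ f[xs]≤f[argmax] {f = lev} x xs)

  -- For `f = 0` the given edge needs some monitor. For `f = 1`, fewer than two monitors would mean
  -- a single one, so `G` would be a forest and the empty list a feedback edge set of size `0`.
  dem-lower-bound : ∀ {f M} → IsFes G f → IsMonitoringSet G M → ∃ (IsEdge G) → f ≤ 1 → f + 1 ≤ ∣ M ∣
  dem-lower-bound {zero} _ monitoring (_ , isEdge) _ = nonempty⇒1≤∣p∣ (proj₁ (proj₂ (monitoring isEdge)))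
  dem-lower-bound {suc zero} {M} (_ , f≤) monitoring (_ , isEdge) _ = ℕ.≮⇒≥ λ ∣M∣<2 →
    let r , r∈M , _ = monitoring isEdge
        monitored : ∀ {e} → IsEdge G e → Monitors G r e
        monitored isEdge′ = let x , x∈M , mon = monitoring isEdge′ in
          subst (λ x → Monitors G x _) (∣p∣≤1⇒subsingleton (s≤s⁻¹ ∣M∣<2) x∈M r∈M) mon
        forest : IsForest (G ∖ [])
        forest = λ { (x ∷ xs , long , un , l) → monitored-by-one⇒forest r monitored
                                                  (x ∷ xs , long , un , Linked.map proj₁ l) }
    in contradiction (f≤ ([] , ([] , [] , forest) , refl)) λ ()
  dem-lower-bound {suc (suc _)} _ _ _ (s≤s ())

-- Upper bound from a breadth-first tree rooted at `zero`.

module _ {n} (G : Graph (suc n)) (connected : IsConnected G) where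

  open Levels G connected zero
  open import Data.List.Membership.DecPropositional (_≟_ {suc n}) using (_∈?_)
  open import Data.List.Membership.DecPropositional (_≟ₑ_ {suc n}) using () renaming (_∈?_ to _∈ₑ?_)

  private
    E : Set
    E = Edge (suc n)

    -- With root `zero`, the vertices that have a parent are the `suc i`; indexing by `i` makes the
    -- number of tree edges `n` by construction.
    parentOf : Fin n → Fin (suc n)
    parentOf i = proj₁ (parent {suc i} (λ ()))

    parentEdge : Fin n → E
    parentEdge i = proj₁ (orient G (proj₁ (proj₂ (parent {suc i} (λ ())))))

    parentEdge-isEdge : ∀ i → IsEdge G (parentEdge i)
    parentEdge-isEdge i = proj₁ (proj₂ (orient G (proj₁ (proj₂ (parent {suc i} (λ ()))))))

    parentEdge-joins : ∀ i → Joins (parentEdge i) (parentOf i) (suc i)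
    parentEdge-joins i = proj₂ (proj₂ (orient G (proj₁ (proj₂ (parent {suc i} (λ ()))))))

    suc-lev-parentOf : ∀ i → suc (lev (parentOf i)) ≡ lev (suc i)
    suc-lev-parentOf i = proj₂ (proj₂ (parent {suc i} (λ ())))

    parentEdge-injective : ∀ {i j} → parentEdge i ≡ parentEdge j → i ≡ j
    parentEdge-injective {i} {j} eq = suc-injective
      (upper-end-unique (parentEdge-joins i)
                        (subst (λ e → Joins e (parentOf j) (suc j)) (≡.sym eq) (parentEdge-joins j))
                        (≤-reflexive (suc-lev-parentOf i)) (≤-reflexive (suc-lev-parentOf j)))

    tree pairs nonTree : List E
    tree  = tabulate parentEdge
    pairs = cartesianProduct (allFin (suc n)) (allFin (suc n))

    nonTree? : Decidable (λ e → IsEdge G e × e ∉ tree)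
    nonTree? e = isEdge? G e ×-dec ¬? (e ∈ₑ? tree)

    nonTree = filter nonTree? pairs

    ∈-nonTree : ∀ {e} → IsEdge G e → e ∉ tree → e ∈ nonTree
    ∈-nonTree isEdge e∉ = ∈-filter⁺ nonTree? (∈-cartesianProduct⁺ (∈-allFin _) (∈-allFin _)) (isEdge , e∉)

    ∈-nonTree⁻ : ∀ {e} → e ∈ nonTree → IsEdge G e × e ∉ tree
    ∈-nonTree⁻ e∈ = proj₂ (∈-filter⁻ nonTree? {xs = pairs} e∈)

    -- The edges in `tree` and `nonTree` are distinct; those outside `F` lie in a forest, so they
    -- number at most `n`, the size of `tree`. Cancelling `n` leaves the claim.
    nonTree-bound : ∀ {F} → IsFeedbackEdgeSet G F → length nonTree ≤ length F
    nonTree-bound {F} (F⊆G , _ , forest) = ℕ.+-cancelˡ-≤ n _ _ (begin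
      n + length nonTree           ≡⟨ cong (_+ length nonTree) (length-tabulate parentEdge) ⟨
      length tree + length nonTree ≡⟨ length-++ tree ⟨
      length all                   ≤⟨ Unique-⊆⇒length≤ _≟ₑ_ unique all⊆ ⟩
      length (rest ++ F)           ≡⟨ length-++ rest ⟩
      length rest + length F       ≤⟨ ℕ.+-monoˡ-≤ (length F) rest-bound ⟩
      n + length F                 ∎)
      where
      open ≤-Reasoning
      ∉F? : Decidable (_∉ F)
      ∉F? e = ¬? (e ∈ₑ? F)
      all rest : List E
      all  = tree ++ nonTree
      rest = filter ∉F? all
      unique : Unique all
      unique = Unique.++⁺ (Unique.tabulate⁺ parentEdge-injective)
        (Unique.filter⁺ nonTree? (Unique.cartesianProduct⁺ (Unique.allFin⁺ _) (Unique.allFin⁺ _)))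
        λ (e∈T , e∈N) → proj₂ (∈-nonTree⁻ e∈N) e∈T
      rest-unique : Unique rest
      rest-unique = Unique.filter⁺ ∉F? unique
      all⊆ : all ⊆ rest ++ F
      all⊆ {e} e∈ with e ∈ₑ? F
      ... | yes e∈F = ∈-++⁺ʳ rest e∈F
      ... | no  e∉F = ∈-++⁺ˡ (∈-filter⁺ ∉F? e∈ e∉F)
      all-edges : ∀ {e} → e ∈ all → IsEdge G e
      all-edges e∈ with ∈-++⁻ tree e∈
      ... | inj₂ e∈N = proj₁ (∈-nonTree⁻ e∈N)
      ... | inj₁ e∈T with ∈-tabulate⁻ e∈T
      ...   | i , refl = parentEdge-isEdge i
      rest⊆ : All (IsEdge (G ∖ F)) rest
      rest⊆ = All.tabulate λ {e} e∈ →
        let e∈all , e∉F = ∈-filter⁻ ∉F? {xs = all} e∈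
            u<v , a     = all-edges e∈all
        -- As `u < v`, absence of the pair from `F` excludes both orientations.
        in u<v , a , e∉F ∘ JoinedBy⇒∈ G F⊆G u<v
      rest-bound : length rest ≤ n
      -- There are `suc n` vertices, hence at most `n` edges.
      rest-bound = s≤s⁻¹ (forest-edges (G ∖ F) forest zero rest⊆ rest-unique)

    -- For ends of equal level the choice of the second is arbitrary, since either end monitors the
    -- edge.
    farEnd : E → Fin (suc n)
    farEnd (u , v) with lev u ℕ.≤? lev v
    ... | yes _ = v
    ... | no  _ = u

    farEnd-joins : ∀ e → ∃[ u ] Joins e (farEnd e) u
    farEnd-joins (u , v) with lev u ℕ.≤? lev v
    ... | yes _ = u , inj₂ refl
    ... | no  _ = v , inj₁ refl

    farEnd-farther : ∀ {e u v} → Joins e u v → lev u < lev v → farEnd e ≡ v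
    farEnd-farther {u = u} {v} (inj₁ refl) u<v with lev u ℕ.≤? lev v
    ... | yes _   = refl
    ... | no  u≰v = contradiction (ℕ.<⇒≤ u<v) u≰v
    farEnd-farther {u = u} {v} (inj₂ refl) u<v with lev v ℕ.≤? lev u
    ... | yes v≤u = contradiction v≤u (ℕ.<⇒≱ u<v)
    ... | no  _   = refl

    candidates : List (Fin (suc n))
    candidates = zero ∷ map farEnd nonTree

    monitoring : ∀ {e} → IsEdge G e → ∃[ x ] x ∈ candidates × Monitors G x e
    monitoring {e} isEdge with e ∈ₑ? tree
    ... | no e∉T = farEnd e , there (∈-map⁺ farEnd (∈-nonTree isEdge e∉T))
                 , monitors-incident G isEdge (proj₂ (farEnd-joins e))
    ... | yes e∈T with ∈-tabulate⁻ e∈T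
    -- A child that is a candidate monitors its parent edge by incidence; otherwise no non-tree edge
    -- has it as far end, and the root takes over.
    ...   | i , refl with suc i ∈? candidates
    ...     | yes v∈M = suc i , v∈M , monitors-incident G isEdge (swap (parentEdge-joins i))
    ...     | no  v∉M = zero , here refl , monitors-last G
      (subst (IsLeast (λ j → Walk G j zero (suc i))) (≡.sym (suc-lev-parentOf i)) (lev-isLeast (suc i)))
      (parentEdge-joins i) only
      where
      -- Were the edge from `w` outside the tree, its far end `suc i` would be a candidate; as a
      -- tree edge with deeper end `suc i` it is the parent edge.
      only : ∀ {w} → Walk G (lev (parentOf i)) zero w → Adj G w (suc i) → w ≡ parentOf i
      only {w} walk a with w<v ← ≤-trans (s≤s (lev≤ walk)) (≤-reflexive (suc-lev-parentOf i)) | orient G a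
      ... | e′ , isEdge′ , K with e′ ∈ₑ? tree
      ...   | no e′∉T = contradiction
        (there (subst (_∈ map farEnd nonTree) (farEnd-farther K w<v)
                      (∈-map⁺ farEnd (∈-nonTree isEdge′ e′∉T)))) v∉M
      ...   | yes e′∈T with ∈-tabulate⁻ e′∈T
      ...     | j , refl with upper-end-unique K (parentEdge-joins j) w<v (≤-reflexive (suc-lev-parentOf j))
      ...       | refl = Joins-injectiveˡ K (parentEdge-joins i)

  dem-upper-bound : ∀ {F} → IsFeedbackEdgeSet G F → ∃[ M ] IsMonitoringSet G M × ∣ M ∣ ≤ length F + 1
  dem-upper-bound {F} feedback =
    ofList candidates , (λ isEdge → let x , x∈M , mon = monitoring isEdge in x , ∈-ofList x∈M , mon) , (begin
      ∣ ofList candidates ∣             ≤⟨ ∣ofList∣≤length candidates ⟩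
      suc (length (map farEnd nonTree)) ≡⟨ cong suc (length-map farEnd nonTree) ⟩
      suc (length nonTree)              ≤⟨ s≤s (nonTree-bound feedback) ⟩
      suc (length F)                    ≡⟨ ℕ.+-comm 1 (length F) ⟩
      length F + 1                      ∎)
    where open ≤-Reasoning

-- The edge in the second part excludes the edgeless graphs, where `f` and `d` are both `0`.
theorem16 : ∀ {n} (G : Graph n) → IsConnected G →
    ∀ {f d} → IsFes G f → IsDem G d →
    (f ≤ 2 → d ≤ f + 1) × (∃ (IsEdge G) → f ≤ 1 → d ≡ f + 1)
theorem16 {zero} G _ _ (_ , d≤) =
  (λ _ → ≤-trans (d≤ ([] , (λ { {() , _} _ }) , refl)) z≤n) , λ { ((() , _) , _) }
theorem16 {suc n} G connected isFes@((F , feedback , refl) , _) ((M , monitoring , refl) , d≤) =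
  (λ _ → upper) , λ edge f≤1 →
    ≤-antisym upper (dem-lower-bound G connected isFes monitoring edge f≤1)
  where
  upper : ∣ M ∣ ≤ length F + 1
  upper with dem-upper-bound G connected feedback
  ... | M′ , monitoring′ , ∣M′∣≤ = ≤-trans (d≤ (M′ , monitoring′ , refl)) ∣M′∣≤
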